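{- Let $(N,S)$ be any one of the four pairs $(\mathrm{nC},\mathrm{sC})$, $(\mathrm{nC3},\mathrm{sC3})$, $(\mathrm{nMC},\mathrm{sMC}^*)$, $(\mathrm{nCN},\mathrm{sCN}^*)$ consisting of a natural deduction system and a sequent calculus. For every finite set $\Gamma$ of formulas and every formula $\beta$: (1) If $\mathcal{D}$ is a derivation in $N$ such that $\mathrm{oa}(\mathcal{D})=\Gamma$ and $\mathrm{end}(\mathcal{D})=\beta$, then the sequent $\Gamma\Rightarrow\beta$ is provable in $S$. (2) If $\Gamma\Rightarrow\beta$ is provable in $S-(\mathrm{cut})$, then we can obtain a derivation $\mathcal{D}'$ in $N$ such that (a) $\mathrm{oa}(\mathcal{D}')=\Gamma$, (b) $\mathrm{end}(\mathcal{D}')=\beta$, and (c) $\mathcal{D}'$ is normal.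
   Context: Formulas are built from countably many propositional variables $p,q,\dots$ using the binary connectives $\land,\lor,\to$ and the unary connective $\sim$. SEQUENT CALCULI. A sequent is an expression $\Gamma\Rightarrow\gamma$ with $\Gamma$ a finite (possibly empty) set of formulas and $\gamma$ a single formula; $\alpha,\Gamma$ means $\{\alpha\}\cup\Gamma$ and $\Gamma,\Delta$ means $\Gamma\cup\Delta$. $S-(\mathrm{cut})$ is $S$ without the rule (cut). The calculus $\mathrm{sC}$ has the following initial sequents and rules ($p$ any propositional variable; $\alpha,\beta,\gamma$ any formulas; $\Gamma,\Delta,\Sigma$ any finite sets of formulas). Initial sequents: (init1) $p,\Gamma\Rightarrow p$; (init2) $\sim p,\Gamma\Rightarrow\sim p$. (cut): from $\Gamma\Rightarrow\alpha$ and $\alpha,\Sigma\Rightarrow\gamma$ infer $\Gamma,\Sigma\Rightarrow\gamma$. ($\to$left): from $\Gamma\Rightarrow\alpha$ and $\beta,\Delta\Rightarrow\gamma$ infer $\alpha\to\beta,\Gamma,\Delta\Rightarrow\gamma$. ($\to$right): from $\alpha,\Gamma\Rightarrow\beta$ infer $\Gamma\Rightarrow\alpha\to\beta$. ($\land$left): from $\alpha,\beta,\Gamma\Rightarrow\gamma$ infer $\alpha\land\beta,\Gamma\Rightarrow\gamma$. ($\land$right): from $\Gamma\Rightarrow\alpha$ and $\Gamma\Rightarrow\beta$ infer $\Gamma\Rightarrow\alpha\land\beta$. ($\lor$left): from $\alpha,\Gamma\Rightarrow\gamma$ and $\beta,\Gamma\Rightarrow\gamma$ infer $\alpha\lor\beta,\Gamma\Rightarrow\gamma$.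 ($\lor$right1), ($\lor$right2): from $\Gamma\Rightarrow\alpha$ (respectively $\Gamma\Rightarrow\beta$) infer $\Gamma\Rightarrow\alpha\lor\beta$. ($\sim$left): from $\alpha,\Gamma\Rightarrow\gamma$ infer $\sim\sim\alpha,\Gamma\Rightarrow\gamma$. ($\sim$right): from $\Gamma\Rightarrow\alpha$ infer $\Gamma\Rightarrow\sim\sim\alpha$. ($\sim\to$left): from $\Gamma\Rightarrow\alpha$ and $\sim\beta,\Delta\Rightarrow\gamma$ infer $\sim(\alpha\to\beta),\Gamma,\Delta\Rightarrow\gamma$. ($\sim\to$right): from $\alpha,\Gamma\Rightarrow\sim\beta$ infer $\Gamma\Rightarrow\sim(\alpha\to\beta)$. ($\sim\land$left): from $\sim\alpha,\Gamma\Rightarrow\gamma$ and $\sim\beta,\Gamma\Rightarrow\gamma$ infer $\sim(\alpha\land\beta),\Gamma\Rightarrow\gamma$. ($\sim\land$right1), ($\sim\land$right2): from $\Gamma\Rightarrow\sim\alpha$ (respectively $\Gamma\Rightarrow\sim\beta$) infer $\Gamma\Rightarrow\sim(\alpha\land\beta)$. ($\sim\lor$left): from $\sim\alpha,\sim\beta,\Gamma\Rightarrow\gamma$ infer $\sim(\alpha\lor\beta),\Gamma\Rightarrow\gamma$. ($\sim\lor$right): from $\Gamma\Rightarrow\sim\alpha$ and $\Gamma\Rightarrow\sim\beta$ infer $\Gamma\Rightarrow\sim(\alpha\lor\beta)$. Additional rules: (ex-middle): from $\sim\alpha,\Gamma\Rightarrow\gamma$ and $\alpha,\Gamma\Rightarrow\gamma$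 infer $\Gamma\Rightarrow\gamma$. (g-ex-middle): from $\alpha\to\beta,\Gamma\Rightarrow\gamma$ and $\alpha,\Gamma\Rightarrow\gamma$ infer $\Gamma\Rightarrow\gamma$. $\mathrm{sC3}=\mathrm{sC}+$(ex-middle); $\mathrm{sMC}^*=\mathrm{sC}+$(g-ex-middle); $\mathrm{sCN}^*=\mathrm{sC3}+$(g-ex-middle). NATURAL DEDUCTION SYSTEMS. Derivations are Gentzen-style trees; a single assumption $\alpha$ is a derivation of $\alpha$ from itself. $[\alpha]$ marks an assumption discharged by the rule. In ($\to$I), and likewise in ($\sim\to$I), the discharge can be vacuous. The rules of $\mathrm{nC}$ are: ($\to$I): from a derivation of $\beta$ from $[\alpha]$, infer $\alpha\to\beta$. ($\to$E): from $\alpha\to\beta$ and $\alpha$ infer $\beta$. ($\land$I): from $\alpha$ and $\beta$ infer $\alpha\land\beta$. ($\land$E1), ($\land$E2): from $\alpha\land\beta$ infer $\alpha$ (respectively $\beta$). ($\lor$I1), ($\lor$I2): from $\alpha$ (respectively $\beta$) infer $\alpha\lor\beta$. ($\lor$E): from $\alpha\lor\beta$, a derivation of $\gamma$ from $[\alpha]$, and a derivation of $\gamma$ from $[\beta]$, infer $\gamma$. ($\sim\sim$I): from $\alpha$ infer $\sim\sim\alpha$. ($\sim\sim$E): from $\sim\sim\alpha$ infer $\alpha$. ($\sim\to$I): from a derivation of $\sim\beta$ from $[\alpha]$, infer $\sim(\alpha\to\beta)$. ($\sim\to$E): from $\sim(\alpha\to\beta)$ and $\alpha$ infer $\sim\beta$.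 ($\sim\land$I1), ($\sim\land$I2): from $\sim\alpha$ (respectively $\sim\beta$) infer $\sim(\alpha\land\beta)$. ($\sim\land$E): from $\sim(\alpha\land\beta)$, a derivation of $\gamma$ from $[\sim\alpha]$, and a derivation of $\gamma$ from $[\sim\beta]$, infer $\gamma$. ($\sim\lor$I): from $\sim\alpha$ and $\sim\beta$ infer $\sim(\alpha\lor\beta)$. ($\sim\lor$E1), ($\sim\lor$E2): from $\sim(\alpha\lor\beta)$ infer $\sim\alpha$ (respectively $\sim\beta$). Additional rules: (EM): from a derivation of $\gamma$ from $[\sim\alpha]$ and a derivation of $\gamma$ from $[\alpha]$, infer $\gamma$. (GEM): from a derivation of $\gamma$ from $[\alpha\to\beta]$ and a derivation of $\gamma$ from $[\alpha]$, infer $\gamma$. $\mathrm{nC3}=\mathrm{nC}+$(EM); $\mathrm{nMC}=\mathrm{nC}+$(GEM); $\mathrm{nCN}=\mathrm{nC3}+$(GEM). For a derivation $\mathcal{D}$, $\mathrm{oa}(\mathcal{D})$ is the set of its open (undischarged) assumptions and $\mathrm{end}(\mathcal{D})$ is its end-formula. The rules whose names contain I, together with (EM) and (GEM), are called introduction rules; the rules whose names contain E, E1 or E2 (other than (EM), (GEM)) are called elimination rules. The major premise of an elimination rule is, as usual, the premise displaying the eliminated connective, i.e. the first premise listed above for it; (EM) and (GEM) have no major or minor premises. A formula occurring in a derivation is a maximum formula if it is (i) the conclusion of an introduction rule, of ($\lor$E), or of ($\sim\land$E), and (ii) the major premise of an elimination rule. A derivation is normal if it contains no maximum formula.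
   Formalization: In (2)(a) the formal theorem proves oa(D′) ⊆ Γ instead of oa(D′) = Γ; equality is false, e.g. p,q ⇒ p is an initial sequent of sC, but the only normal nC-derivation of p with open assumptions among p,q is p alone. -}

module Defs where

open import Data.Nat.Base using (ℕ; suc)
open import Data.List.Base using (List; []; _∷_; [_]; _++_; replicate)
open import Data.List.Relation.Binary.BagAndSetEquality using (_∼[_]_; set)
open import Data.List.Relation.Ternary.Interleaving.Propositional using (Interleaving)
open import Data.Product.Base using (∃)
open import Data.Sum.Base using (_⊎_)
open import Data.Empty using (⊥)
open import Data.Unit.Base using (⊤)
open import Relation.Nullary.Negation.Core using (¬_)
open import Relation.Binary.PropositionalEquality.Core using (_≡_)

infix  9 ∼_
infixr 8 _∧_
infixr 7 _∨_
infixr 6 _⊃_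

data Formula : Set where
  var         : ℕ → Formula
  _∧_ _∨_ _⊃_ : Formula → Formula → Formula
  ∼_          : Formula → Formula

-- One index per pair of systems: C is (nC , sC), C3 is (nC3 , sC3),
-- MC is (nMC , sMC*), CN is (nCN , sCN*).
data Logic : Set where
  C C3 MC CN : Logic

-- The logics with (EM) / (ex-middle).
data HasEM : Logic → Set where
  C3 : HasEM C3
  CN : HasEM CN

-- The logics with (GEM) / (g-ex-middle).
data HasGEM : Logic → Set where
  MC : HasGEM MC
  CN : HasGEM CN

data CutMode : Set where
  with-cut without-cut : CutMode

private
  variable
    α β γ   : Formula
    Γ Δ Θ   : List Formula
    Θ₁ Θ₂   : List Formula
    Θ₃ Δ₁ Δ₂ : List Formula

-- Sequent calculi

infix 2 _[_]⊢_⇒_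

-- Antecedents are finite sets, represented by lists. The constructor `reset`
-- is not a rule of the calculus: it identifies lists with the same elements,
-- so that α ∷ Γ stands for {α} ∪ Γ and Γ ++ Δ for Γ ∪ Δ.
data _[_]⊢_⇒_ (S : Logic) (c : CutMode) : List Formula → Formula → Set where
  reset  : Γ ∼[ set ] Δ → S [ c ]⊢ Γ ⇒ γ → S [ c ]⊢ Δ ⇒ γ

  init₁  : ∀ p → S [ c ]⊢ var p ∷ Γ ⇒ var p
  init₂  : ∀ p → S [ c ]⊢ ∼ var p ∷ Γ ⇒ ∼ var p

  cut    : c ≡ with-cut →
           S [ c ]⊢ Γ ⇒ α → S [ c ]⊢ α ∷ Δ ⇒ γ → S [ c ]⊢ Γ ++ Δ ⇒ γ

  ⊃-left   : S [ c ]⊢ Γ ⇒ α → S [ c ]⊢ β ∷ Δ ⇒ γ → S [ c ]⊢ α ⊃ β ∷ Γ ++ Δ ⇒ γ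
  ⊃-right  : S [ c ]⊢ α ∷ Γ ⇒ β → S [ c ]⊢ Γ ⇒ α ⊃ β
  ∧-left   : S [ c ]⊢ α ∷ β ∷ Γ ⇒ γ → S [ c ]⊢ α ∧ β ∷ Γ ⇒ γ
  ∧-right  : S [ c ]⊢ Γ ⇒ α → S [ c ]⊢ Γ ⇒ β → S [ c ]⊢ Γ ⇒ α ∧ β
  ∨-left   : S [ c ]⊢ α ∷ Γ ⇒ γ → S [ c ]⊢ β ∷ Γ ⇒ γ → S [ c ]⊢ α ∨ β ∷ Γ ⇒ γ
  ∨-right₁ : S [ c ]⊢ Γ ⇒ α → S [ c ]⊢ Γ ⇒ α ∨ β
  ∨-right₂ : S [ c ]⊢ Γ ⇒ β → S [ c ]⊢ Γ ⇒ α ∨ β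

  ∼-left    : S [ c ]⊢ α ∷ Γ ⇒ γ → S [ c ]⊢ ∼ ∼ α ∷ Γ ⇒ γ
  ∼-right   : S [ c ]⊢ Γ ⇒ α → S [ c ]⊢ Γ ⇒ ∼ ∼ α
  ∼⊃-left   : S [ c ]⊢ Γ ⇒ α → S [ c ]⊢ ∼ β ∷ Δ ⇒ γ → S [ c ]⊢ ∼ (α ⊃ β) ∷ Γ ++ Δ ⇒ γ
  ∼⊃-right  : S [ c ]⊢ α ∷ Γ ⇒ ∼ β → S [ c ]⊢ Γ ⇒ ∼ (α ⊃ β)
  ∼∧-left   : S [ c ]⊢ ∼ α ∷ Γ ⇒ γ → S [ c ]⊢ ∼ β ∷ Γ ⇒ γ → S [ c ]⊢ ∼ (α ∧ β) ∷ Γ ⇒ γ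
  ∼∧-right₁ : S [ c ]⊢ Γ ⇒ ∼ α → S [ c ]⊢ Γ ⇒ ∼ (α ∧ β)
  ∼∧-right₂ : S [ c ]⊢ Γ ⇒ ∼ β → S [ c ]⊢ Γ ⇒ ∼ (α ∧ β)
  ∼∨-left   : S [ c ]⊢ ∼ α ∷ ∼ β ∷ Γ ⇒ γ → S [ c ]⊢ ∼ (α ∨ β) ∷ Γ ⇒ γ
  ∼∨-right  : S [ c ]⊢ Γ ⇒ ∼ α → S [ c ]⊢ Γ ⇒ ∼ β → S [ c ]⊢ Γ ⇒ ∼ (α ∨ β)

  ex-middle   : HasEM S → S [ c ]⊢ ∼ α ∷ Γ ⇒ γ → S [ c ]⊢ α ∷ Γ ⇒ γ → S [ c ]⊢ Γ ⇒ γ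
  g-ex-middle : HasGEM S → S [ c ]⊢ α ⊃ β ∷ Γ ⇒ γ → S [ c ]⊢ α ∷ Γ ⇒ γ → S [ c ]⊢ Γ ⇒ γ

-- Natural deduction

-- Δ results from Θ by discharging some, not necessarily all, occurrences of α.
-- `Discharge⁺` excludes vacuous discharge.
Discharge Discharge⁺ : Formula → List Formula → List Formula → Set
Discharge  α Θ Δ = ∃ λ n → Interleaving (replicate n α) Δ Θ
Discharge⁺ α Θ Δ = ∃ λ n → Interleaving (replicate (suc n) α) Δ Θ

infix 2 _▷_⊢_

-- N ▷ Θ ⊢ β is the type of derivation trees of N with end-formula β whose
-- undischarged leaves, read from left to right, are exactly Θ: there is no
-- weakening, and every member of Θ is an open assumption occurring in the tree.
data _▷_⊢_ (N : Logic) : List Formula → Formula → Set where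
  assume : ∀ α → N ▷ [ α ] ⊢ α

  ⊃I  : N ▷ Θ ⊢ β → Discharge α Θ Δ → N ▷ Δ ⊢ α ⊃ β
  ⊃E  : N ▷ Θ₁ ⊢ α ⊃ β → N ▷ Θ₂ ⊢ α → N ▷ Θ₁ ++ Θ₂ ⊢ β
  ∧I  : N ▷ Θ₁ ⊢ α → N ▷ Θ₂ ⊢ β → N ▷ Θ₁ ++ Θ₂ ⊢ α ∧ β
  ∧E₁ : N ▷ Θ ⊢ α ∧ β → N ▷ Θ ⊢ α
  ∧E₂ : N ▷ Θ ⊢ α ∧ β → N ▷ Θ ⊢ β
  ∨I₁ : N ▷ Θ ⊢ α → N ▷ Θ ⊢ α ∨ β
  ∨I₂ : N ▷ Θ ⊢ β → N ▷ Θ ⊢ α ∨ β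
  ∨E  : N ▷ Θ₁ ⊢ α ∨ β →
        N ▷ Θ₂ ⊢ γ → Discharge⁺ α Θ₂ Δ₁ →
        N ▷ Θ₃ ⊢ γ → Discharge⁺ β Θ₃ Δ₂ →
        N ▷ Θ₁ ++ Δ₁ ++ Δ₂ ⊢ γ

  ∼∼I  : N ▷ Θ ⊢ α → N ▷ Θ ⊢ ∼ ∼ α
  ∼∼E  : N ▷ Θ ⊢ ∼ ∼ α → N ▷ Θ ⊢ α
  ∼⊃I  : N ▷ Θ ⊢ ∼ β → Discharge α Θ Δ → N ▷ Δ ⊢ ∼ (α ⊃ β)
  ∼⊃E  : N ▷ Θ₁ ⊢ ∼ (α ⊃ β) → N ▷ Θ₂ ⊢ α → N ▷ Θ₁ ++ Θ₂ ⊢ ∼ β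
  ∼∧I₁ : N ▷ Θ ⊢ ∼ α → N ▷ Θ ⊢ ∼ (α ∧ β)
  ∼∧I₂ : N ▷ Θ ⊢ ∼ β → N ▷ Θ ⊢ ∼ (α ∧ β)
  ∼∧E  : N ▷ Θ₁ ⊢ ∼ (α ∧ β) →
         N ▷ Θ₂ ⊢ γ → Discharge⁺ (∼ α) Θ₂ Δ₁ →
         N ▷ Θ₃ ⊢ γ → Discharge⁺ (∼ β) Θ₃ Δ₂ →
         N ▷ Θ₁ ++ Δ₁ ++ Δ₂ ⊢ γ
  ∼∨I  : N ▷ Θ₁ ⊢ ∼ α → N ▷ Θ₂ ⊢ ∼ β → N ▷ Θ₁ ++ Θ₂ ⊢ ∼ (α ∨ β)
  ∼∨E₁ : N ▷ Θ ⊢ ∼ (α ∨ β) → N ▷ Θ ⊢ ∼ α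
  ∼∨E₂ : N ▷ Θ ⊢ ∼ (α ∨ β) → N ▷ Θ ⊢ ∼ β

  EM  : HasEM N →
        N ▷ Θ₁ ⊢ γ → Discharge⁺ (∼ α) Θ₁ Δ₁ →
        N ▷ Θ₂ ⊢ γ → Discharge⁺ α Θ₂ Δ₂ →
        N ▷ Δ₁ ++ Δ₂ ⊢ γ
  GEM : HasGEM N →
        N ▷ Θ₁ ⊢ γ → Discharge⁺ (α ⊃ β) Θ₁ Δ₁ →
        N ▷ Θ₂ ⊢ γ → Discharge⁺ α Θ₂ Δ₂ →
        N ▷ Δ₁ ++ Δ₂ ⊢ γ

record Derivation (N : Logic) : Set where
  constructor derivation
  field
    {oa}  : List Formula
    {end} : Formula
    tree  : N ▷ oa ⊢ end

open Derivation public

-- The end-formula is the conclusion of an introduction rule (EM and GEM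
-- included), of (∨E), or of (∼∧E).
MaximumCandidate : ∀ {N} → N ▷ Θ ⊢ α → Set
MaximumCandidate (assume _)        = ⊥
MaximumCandidate (⊃I _ _)          = ⊤
MaximumCandidate (⊃E _ _)          = ⊥
MaximumCandidate (∧I _ _)          = ⊤
MaximumCandidate (∧E₁ _)           = ⊥
MaximumCandidate (∧E₂ _)           = ⊥
MaximumCandidate (∨I₁ _)           = ⊤
MaximumCandidate (∨I₂ _)           = ⊤
MaximumCandidate (∨E _ _ _ _ _)    = ⊤
MaximumCandidate (∼∼I _)           = ⊤
MaximumCandidate (∼∼E _)           = ⊥
MaximumCandidate (∼⊃I _ _)         = ⊤
MaximumCandidate (∼⊃E _ _)         = ⊥
MaximumCandidate (∼∧I₁ _)          = ⊤
MaximumCandidate (∼∧I₂ _)          = ⊤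
MaximumCandidate (∼∧E _ _ _ _ _)   = ⊤
MaximumCandidate (∼∨I _ _)         = ⊤
MaximumCandidate (∼∨E₁ _)          = ⊥
MaximumCandidate (∼∨E₂ _)          = ⊥
MaximumCandidate (EM _ _ _ _ _)    = ⊤
MaximumCandidate (GEM _ _ _ _ _)   = ⊤

-- D contains a maximum formula. Major premises are those at which
-- `MaximumCandidate` is tested.
HasMaximum : ∀ {N} → N ▷ Θ ⊢ α → Set
HasMaximum (assume _)         = ⊥
HasMaximum (⊃I D _)           = HasMaximum D
HasMaximum (⊃E D E)           = MaximumCandidate D ⊎ HasMaximum D ⊎ HasMaximum E
HasMaximum (∧I D E)           = HasMaximum D ⊎ HasMaximum E
HasMaximum (∧E₁ D)            = MaximumCandidate D ⊎ HasMaximum D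
HasMaximum (∧E₂ D)            = MaximumCandidate D ⊎ HasMaximum D
HasMaximum (∨I₁ D)            = HasMaximum D
HasMaximum (∨I₂ D)            = HasMaximum D
HasMaximum (∨E D E _ F _)     = MaximumCandidate D ⊎ HasMaximum D ⊎ HasMaximum E ⊎ HasMaximum F
HasMaximum (∼∼I D)            = HasMaximum D
HasMaximum (∼∼E D)            = MaximumCandidate D ⊎ HasMaximum D
HasMaximum (∼⊃I D _)          = HasMaximum D
HasMaximum (∼⊃E D E)          = MaximumCandidate D ⊎ HasMaximum D ⊎ HasMaximum E
HasMaximum (∼∧I₁ D)           = HasMaximum D
HasMaximum (∼∧I₂ D)           = HasMaximum D
HasMaximum (∼∧E D E _ F _)    = MaximumCandidate D ⊎ HasMaximum D ⊎ HasMaximum E ⊎ HasMaximum F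
HasMaximum (∼∨I D E)          = HasMaximum D ⊎ HasMaximum E
HasMaximum (∼∨E₁ D)           = MaximumCandidate D ⊎ HasMaximum D
HasMaximum (∼∨E₂ D)           = MaximumCandidate D ⊎ HasMaximum D
HasMaximum (EM _ D _ E _)     = HasMaximum D ⊎ HasMaximum E
HasMaximum (GEM _ D _ E _)    = HasMaximum D ⊎ HasMaximum E

Normal : ∀ {N} → Derivation N → Set
Normal D = ¬ HasMaximum (tree D)

{-# OPTIONS --safe #-}
-- Soundness is an induction on natural deductions. In the presence of (cut), weakening is
-- a cut against an identity sequent.
--
-- Conversely, a cut-free proof of Γ ⇒ γ is translated under an environment that
-- assigns to each formula of Γ a normal derivation which does not end in an
-- introduction, in (∨E) or in (∼∧E). A left rule eliminates the derivation assigned to its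
-- principal formula, hence a non-candidate for a maximum formula, and thus no
-- substitution into finished derivations is ever needed.
module Submission where

open import Defs
open import Data.List.Base using (List; []; _∷_; _++_; replicate)
open import Data.List.Relation.Binary.BagAndSetEquality using (_∼[_]_; set; ++-idempotent)
open import Data.List.Relation.Binary.Subset.Propositional using (_⊆_)
open import Data.List.Relation.Binary.Subset.Propositional.Properties
  using (⊆-refl; ⊆-trans; ∷⁺ʳ; ∈-∷⁺ʳ; xs⊆x∷xs; xs⊆xs++ys; xs⊆ys++xs)
open import Data.List.Membership.Propositional using (_∈_)
open import Data.List.Membership.Propositional.Properties using (∈-++⁻)
open import Data.List.Relation.Ternary.Interleaving.Propositional
  using (Interleaving; []; consˡ; consʳ)
open import Data.List.Relation.Unary.Any using (here; there)
open import Data.Nat.Base using (suc; zero)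
open import Data.Product.Base using (_×_; _,_; Σ-syntax; ∃-syntax)
open import Data.Sum.Base using ([_,_]′)
open import Function.Base using (_∘_; id)
open import Function.Bundles using (mk⇔; module Equivalence)
open import Relation.Nullary.Negation.Core using (¬_)
open import Relation.Binary.PropositionalEquality.Core using (_≡_; refl)

private
  variable
    α β γ : Formula
    Γ Δ Θ Θ₁ Θ₂ : List Formula
    L : Logic
    c : CutMode

-- Antecedents as sets, and identity sequents.

⊆-antisym : Γ ⊆ Δ → Δ ⊆ Γ → Γ ∼[ set ] Δ
⊆-antisym p q = mk⇔ p q

++-⊆ : Θ₁ ⊆ Γ → Θ₂ ⊆ Γ → Θ₁ ++ Θ₂ ⊆ Γ
++-⊆ {Θ₁ = Θ₁} p q = [ p , q ]′ ∘ ∈-++⁻ Θ₁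

-- Contraction comes for free because antecedents are sets. It lets a left rule act on a formula
-- anywhere in `Γ` and keeps that formula available.
absorb : α ∈ Γ → L [ c ]⊢ α ∷ Γ ⇒ γ → L [ c ]⊢ Γ ⇒ γ
absorb i = reset (⊆-antisym (∈-∷⁺ʳ i ⊆-refl) (xs⊆x∷xs _ _))

absorb-++ : α ∈ Γ → L [ c ]⊢ α ∷ Γ ++ Γ ⇒ γ → L [ c ]⊢ Γ ⇒ γ
absorb-++ {Γ = Γ} i =
  reset (⊆-antisym (∈-∷⁺ʳ i (++-⊆ ⊆-refl ⊆-refl)) (there ∘ xs⊆xs++ys Γ Γ))

shared-⊃-left : α ⊃ β ∈ Γ → L [ c ]⊢ Γ ⇒ α → L [ c ]⊢ β ∷ Γ ⇒ γ → L [ c ]⊢ Γ ⇒ γ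
shared-⊃-left i d e = absorb-++ i (⊃-left d e)

shared-∼⊃-left : ∼ (α ⊃ β) ∈ Γ →
  L [ c ]⊢ Γ ⇒ α → L [ c ]⊢ ∼ β ∷ Γ ⇒ γ → L [ c ]⊢ Γ ⇒ γ
shared-∼⊃-left i d e = absorb-++ i (∼⊃-left d e)

mutual
  -- The initial sequents cover only variables and their negations. The rules for a negated compound
  -- depend on the connective under `∼` and lead to negated components, so `identity-∼` recurses on
  -- the formula below the negation.
  identity : ∀ α → α ∈ Γ → L [ c ]⊢ Γ ⇒ α
  identity (var p) i = absorb i (init₁ p)
  identity (α ∧ β) i = absorb i (∧-left (∧-right
    (identity α (here refl)) (identity β (there (here refl)))))
  identity (α ∨ β) i = absorb i (∨-left
    (∨-right₁ (identity α (here refl))) (∨-right₂ (identity β (here refl))))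
  identity (α ⊃ β) i = ⊃-right (shared-⊃-left (there i)
    (identity α (here refl)) (identity β (here refl)))
  identity (∼ α) i = identity-∼ α i

  identity-∼ : ∀ α → ∼ α ∈ Γ → L [ c ]⊢ Γ ⇒ ∼ α
  identity-∼ (var p) i = absorb i (init₂ p)
  identity-∼ (α ∧ β) i = absorb i (∼∧-left
    (∼∧-right₁ (identity-∼ α (here refl))) (∼∧-right₂ (identity-∼ β (here refl))))
  identity-∼ (α ∨ β) i = absorb i (∼∨-left (∼∨-right
    (identity-∼ α (here refl)) (identity-∼ β (there (here refl)))))
  identity-∼ (α ⊃ β) i = ∼⊃-right (shared-∼⊃-left (there i)
    (identity α (here refl)) (identity-∼ β (here refl)))
  identity-∼ (∼ α) i = absorb i (∼-left (∼-right (identity α (here refl))))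

-- From natural deduction to sequents with cut.

weaken : Γ ⊆ Δ → L [ with-cut ]⊢ Γ ⇒ γ → L [ with-cut ]⊢ Δ ⇒ γ
weaken {Γ = Γ} p d =
  reset (⊆-antisym (++-⊆ p ⊆-refl) (xs⊆ys++xs _ Γ)) (cut refl d (identity _ (here refl)))

shared-cut : L [ with-cut ]⊢ Γ ⇒ α → L [ with-cut ]⊢ α ∷ Γ ⇒ γ → L [ with-cut ]⊢ Γ ⇒ γ
shared-cut {Γ = Γ} d e = reset (++-idempotent Γ) (cut refl d e)

interleaving⇒⊆ : ∀ n → Interleaving (replicate n α) Δ Θ → Θ ⊆ α ∷ Δ
interleaving⇒⊆ (suc n) (consˡ i) = ∈-∷⁺ʳ (here refl) (interleaving⇒⊆ n i)
interleaving⇒⊆ n       (consʳ i) = λ where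
  (here eq) → there (here eq)
  (there j) → ∷⁺ʳ _ (xs⊆x∷xs _ _) (interleaving⇒⊆ n i j)
interleaving⇒⊆ zero    []        = λ ()

discharge⇒⊆ : Discharge α Θ Δ → Δ ⊆ Γ → Θ ⊆ α ∷ Γ
discharge⇒⊆ (n , i) p = ⊆-trans (interleaving⇒⊆ n i) (∷⁺ʳ _ p)

discharge⁺⇒⊆ : Discharge⁺ α Θ Δ → Δ ⊆ Γ → Θ ⊆ α ∷ Γ
discharge⁺⇒⊆ (n , i) = discharge⇒⊆ (suc n , i)

-- Allowing any `Γ` that contains the leaves brings all premises of a rule to one context and covers
-- vacuous discharge: a premise with discharged `α` is read in `α ∷ Γ`.
sound : L ▷ Θ ⊢ γ → Θ ⊆ Γ → L [ with-cut ]⊢ Γ ⇒ γ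
sound (assume α) p = identity α (p (here refl))
sound (⊃I D d) p = ⊃-right (sound D (discharge⇒⊆ d p))
sound (⊃E {Θ₁ = Θ₁} D E) p =
  -- Modus ponens is two cuts, on `α` and then on `α ⊃ β`, into the sequent `α ⊃ β ∷ α ∷ Γ ⇒ β`.
  shared-cut (sound E (p ∘ xs⊆ys++xs _ Θ₁)) (shared-cut
    (weaken there (sound D (p ∘ xs⊆xs++ys Θ₁ _)))
    (shared-⊃-left (here refl) (identity _ (there (here refl))) (identity _ (here refl))))
sound (∧I {Θ₁ = Θ₁} D E) p =
  ∧-right (sound D (p ∘ xs⊆xs++ys Θ₁ _)) (sound E (p ∘ xs⊆ys++xs _ Θ₁))
sound (∧E₁ D) p = shared-cut (sound D p) (∧-left (identity _ (here refl)))
sound (∧E₂ D) p = shared-cut (sound D p) (∧-left (identity _ (there (here refl))))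
sound (∨I₁ D) p = ∨-right₁ (sound D p)
sound (∨I₂ D) p = ∨-right₂ (sound D p)
sound (∨E {Θ₁ = Θ₁} {Δ₁ = Δ₁} D E d F e) p =
  shared-cut (sound D (p ∘ xs⊆xs++ys Θ₁ _)) (∨-left
    (sound E (discharge⁺⇒⊆ d (p ∘ xs⊆ys++xs _ Θ₁ ∘ xs⊆xs++ys Δ₁ _)))
    (sound F (discharge⁺⇒⊆ e (p ∘ xs⊆ys++xs _ Θ₁ ∘ xs⊆ys++xs _ Δ₁))))
sound (∼∼I D) p = ∼-right (sound D p)
sound (∼∼E D) p = shared-cut (sound D p) (∼-left (identity _ (here refl)))
sound (∼⊃I D d) p = ∼⊃-right (sound D (discharge⇒⊆ d p))
sound (∼⊃E {Θ₁ = Θ₁} D E) p =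
  shared-cut (sound E (p ∘ xs⊆ys++xs _ Θ₁)) (shared-cut
    (weaken there (sound D (p ∘ xs⊆xs++ys Θ₁ _)))
    (shared-∼⊃-left (here refl) (identity _ (there (here refl))) (identity _ (here refl))))
sound (∼∧I₁ D) p = ∼∧-right₁ (sound D p)
sound (∼∧I₂ D) p = ∼∧-right₂ (sound D p)
sound (∼∧E {Θ₁ = Θ₁} {Δ₁ = Δ₁} D E d F e) p =
  shared-cut (sound D (p ∘ xs⊆xs++ys Θ₁ _)) (∼∧-left
    (sound E (discharge⁺⇒⊆ d (p ∘ xs⊆ys++xs _ Θ₁ ∘ xs⊆xs++ys Δ₁ _)))
    (sound F (discharge⁺⇒⊆ e (p ∘ xs⊆ys++xs _ Θ₁ ∘ xs⊆ys++xs _ Δ₁))))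
sound (∼∨I {Θ₁ = Θ₁} D E) p =
  ∼∨-right (sound D (p ∘ xs⊆xs++ys Θ₁ _)) (sound E (p ∘ xs⊆ys++xs _ Θ₁))
sound (∼∨E₁ D) p = shared-cut (sound D p) (∼∨-left (identity _ (here refl)))
sound (∼∨E₂ D) p = shared-cut (sound D p) (∼∨-left (identity _ (there (here refl))))
sound (EM {Δ₁ = Δ₁} em D d E e) p = ex-middle em
  (sound D (discharge⁺⇒⊆ d (p ∘ xs⊆xs++ys Δ₁ _)))
  (sound E (discharge⁺⇒⊆ e (p ∘ xs⊆ys++xs _ Δ₁)))
sound (GEM {Δ₁ = Δ₁} gem D d E e) p = g-ex-middle gem
  (sound D (discharge⁺⇒⊆ d (p ∘ xs⊆xs++ys Δ₁ _)))
  (sound E (discharge⁺⇒⊆ e (p ∘ xs⊆ys++xs _ Δ₁)))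

-- Normal and neutral derivations over a context.

-- The leaves are only included in `Γ`: derivations have no weakening, while initial sequents carry
-- side formulas that need not become leaves.
record NormalFrom (L : Logic) (Γ : List Formula) (γ : Formula) : Set where
  constructor normal
  field
    {leaves} : List Formula
    leaves⊆  : leaves ⊆ Γ
    deriv    : L ▷ leaves ⊢ γ
    no-max   : ¬ HasMaximum deriv

record NeutralFrom (L : Logic) (Γ : List Formula) (γ : Formula) : Set where
  constructor neutral
  field
    {leaves} : List Formula
    leaves⊆  : leaves ⊆ Γ
    deriv    : L ▷ leaves ⊢ γ
    no-max   : ¬ HasMaximum deriv
    no-cand  : ¬ MaximumCandidate deriv

Environment : Logic → List Formula → List Formula → Set
Environment L Γ Δ = ∀ {α} → α ∈ Γ → NeutralFrom L Δ α

neutral⇒normal : NeutralFrom L Γ γ → NormalFrom L Γ γ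
neutral⇒normal (neutral p D m _) = normal p D m

weaken-neutral : NeutralFrom L Γ γ → NeutralFrom L (α ∷ Γ) γ
weaken-neutral (neutral p D m k) = neutral (there ∘ p) D m k

hypothesis : NeutralFrom L (α ∷ Γ) α
hypothesis = neutral (λ { (here eq) → here eq }) (assume _) id id

extend : NeutralFrom L Δ α → Environment L Γ Δ → Environment L (α ∷ Γ) Δ
extend n ρ (here refl) = n
extend n ρ (there i)   = ρ i

lift : Environment L Γ Δ → Environment L (α ∷ Γ) (α ∷ Δ)
lift ρ = extend hypothesis (weaken-neutral ∘ ρ)

-- The membership proof decides for each leaf: one sent to the head is discharged, one sent into `Γ`
-- stays open, even if it equals `α`.
discharge : Θ ⊆ α ∷ Γ → ∃[ Δ ] Discharge α Θ Δ × Δ ⊆ Γ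
discharge {Θ = []}    p = [] , (zero , []) , λ ()
discharge {Θ = x ∷ Θ} p with discharge {Θ = Θ} (p ∘ there) | p (here refl)
... | Δ , (n , i) , q | here refl = Δ , (suc n , consˡ i) , q
... | Δ , (n , i) , q | there j   = x ∷ Δ , (n , consʳ i) , ∈-∷⁺ʳ j q

interleaving-[]ˡ : Interleaving [] Δ Θ → Θ ⊆ Δ
interleaving-[]ˡ []        = id
interleaving-[]ˡ (consʳ i) = ∷⁺ʳ _ (interleaving-[]ˡ i)

-- Since (∨E), (∼∧E), (EM) and (GEM) forbid vacuous discharge, they are applied
-- only if both case assumptions are used; otherwise one of the two case
-- derivations already is as desired.
by-cases : NormalFrom L (α ∷ Γ) γ → NormalFrom L (β ∷ Γ) γ →
  (∀ {Θ₁ Θ₂ Δ₁ Δ₂} (D : L ▷ Θ₁ ⊢ γ) → ¬ HasMaximum D → Discharge⁺ α Θ₁ Δ₁ → Δ₁ ⊆ Γ →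
     (E : L ▷ Θ₂ ⊢ γ) → ¬ HasMaximum E → Discharge⁺ β Θ₂ Δ₂ → Δ₂ ⊆ Γ →
     NormalFrom L Γ γ) →
  NormalFrom L Γ γ
by-cases (normal p D m) (normal q E m′) f with discharge p | discharge q
... | _ , (zero  , i) , r | _                   = normal (r ∘ interleaving-[]ˡ i) D m
... | _ , (suc _ , _) , _ | _ , (zero  , j) , s = normal (s ∘ interleaving-[]ˡ j) E m′
... | _ , (suc n , i) , r | _ , (suc k , j) , s = f D m (n , i) r E m′ (k , j) s

⊃I-normal : NormalFrom L (α ∷ Γ) β → NormalFrom L Γ (α ⊃ β)
⊃I-normal (normal p D m) with discharge p
... | _ , d , q = normal q (⊃I D d) m

∼⊃I-normal : NormalFrom L (α ∷ Γ) (∼ β) → NormalFrom L Γ (∼ (α ⊃ β))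
∼⊃I-normal (normal p D m) with discharge p
... | _ , d , q = normal q (∼⊃I D d) m

-- The conclusion of (`⊃E`) is no candidate, so the result can again be a major premise. Only the
-- major premise is tested, hence a normal minor premise suffices.
⊃E-neutral : NeutralFrom L Γ (α ⊃ β) → NormalFrom L Γ α → NeutralFrom L Γ β
⊃E-neutral (neutral p D m k) (normal q E m′) =
  neutral (++-⊆ p q) (⊃E D E) [ k , [ m , m′ ]′ ]′ id

∼⊃E-neutral : NeutralFrom L Γ (∼ (α ⊃ β)) → NormalFrom L Γ α → NeutralFrom L Γ (∼ β)
∼⊃E-neutral (neutral p D m k) (normal q E m′) =
  neutral (++-⊆ p q) (∼⊃E D E) [ k , [ m , m′ ]′ ]′ id

∧E₁-neutral : NeutralFrom L Γ (α ∧ β) → NeutralFrom L Γ α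
∧E₁-neutral (neutral p D m k) = neutral p (∧E₁ D) [ k , m ]′ id

∧E₂-neutral : NeutralFrom L Γ (α ∧ β) → NeutralFrom L Γ β
∧E₂-neutral (neutral p D m k) = neutral p (∧E₂ D) [ k , m ]′ id

∼∼E-neutral : NeutralFrom L Γ (∼ ∼ α) → NeutralFrom L Γ α
∼∼E-neutral (neutral p D m k) = neutral p (∼∼E D) [ k , m ]′ id

∼∨E₁-neutral : NeutralFrom L Γ (∼ (α ∨ β)) → NeutralFrom L Γ (∼ α)
∼∨E₁-neutral (neutral p D m k) = neutral p (∼∨E₁ D) [ k , m ]′ id

∼∨E₂-neutral : NeutralFrom L Γ (∼ (α ∨ β)) → NeutralFrom L Γ (∼ β)
∼∨E₂-neutral (neutral p D m k) = neutral p (∼∨E₂ D) [ k , m ]′ id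

∧I-normal : NormalFrom L Γ α → NormalFrom L Γ β → NormalFrom L Γ (α ∧ β)
∧I-normal (normal p D m) (normal q E m′) = normal (++-⊆ p q) (∧I D E) [ m , m′ ]′

∼∨I-normal : NormalFrom L Γ (∼ α) → NormalFrom L Γ (∼ β) → NormalFrom L Γ (∼ (α ∨ β))
∼∨I-normal (normal p D m) (normal q E m′) = normal (++-⊆ p q) (∼∨I D E) [ m , m′ ]′

∨I₁-normal : NormalFrom L Γ α → NormalFrom L Γ (α ∨ β)
∨I₁-normal (normal p D m) = normal p (∨I₁ D) m

∨I₂-normal : NormalFrom L Γ β → NormalFrom L Γ (α ∨ β)
∨I₂-normal (normal p D m) = normal p (∨I₂ D) m

∼∼I-normal : NormalFrom L Γ α → NormalFrom L Γ (∼ ∼ α)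
∼∼I-normal (normal p D m) = normal p (∼∼I D) m

∼∧I₁-normal : NormalFrom L Γ (∼ α) → NormalFrom L Γ (∼ (α ∧ β))
∼∧I₁-normal (normal p D m) = normal p (∼∧I₁ D) m

∼∧I₂-normal : NormalFrom L Γ (∼ β) → NormalFrom L Γ (∼ (α ∧ β))
∼∧I₂-normal (normal p D m) = normal p (∼∧I₂ D) m

-- The conclusion of (`∨E`) is a candidate, so the result is normal but not neutral and never enters
-- an environment.
∨E-normal : NeutralFrom L Γ (α ∨ β) →
  NormalFrom L (α ∷ Γ) γ → NormalFrom L (β ∷ Γ) γ → NormalFrom L Γ γ
∨E-normal (neutral p D m k) x y = by-cases x y λ E m₁ d q F m₂ e r →
  normal (++-⊆ p (++-⊆ q r)) (∨E D E d F e) [ k , [ m , [ m₁ , m₂ ]′ ]′ ]′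

∼∧E-normal : NeutralFrom L Γ (∼ (α ∧ β)) →
  NormalFrom L (∼ α ∷ Γ) γ → NormalFrom L (∼ β ∷ Γ) γ → NormalFrom L Γ γ
∼∧E-normal (neutral p D m k) x y = by-cases x y λ E m₁ d q F m₂ e r →
  normal (++-⊆ p (++-⊆ q r)) (∼∧E D E d F e) [ k , [ m , [ m₁ , m₂ ]′ ]′ ]′

EM-normal : HasEM L →
  NormalFrom L (∼ α ∷ Γ) γ → NormalFrom L (α ∷ Γ) γ → NormalFrom L Γ γ
EM-normal em x y = by-cases x y λ D m d q E m′ e r →
  normal (++-⊆ q r) (EM em D d E e) [ m , m′ ]′

GEM-normal : HasGEM L →
  NormalFrom L (α ⊃ β ∷ Γ) γ → NormalFrom L (α ∷ Γ) γ → NormalFrom L Γ γ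
GEM-normal gem x y = by-cases x y λ D m d q E m′ e r →
  normal (++-⊆ q r) (GEM gem D d E e) [ m , m′ ]′

-- From cut-free proofs to normal derivations.

-- `Γ` and `Δ` vary separately: left rules that discharge nothing change only `Γ`, while discharging
-- rules extend both by `lift`. The case of `cut` is excluded by its premise
-- `without-cut ≡ with-cut`.
normalise : L [ without-cut ]⊢ Γ ⇒ γ → Environment L Γ Δ → NormalFrom L Δ γ
normalise (reset s d) ρ = normalise d (ρ ∘ Equivalence.to s)
normalise (init₁ p) ρ = neutral⇒normal (ρ (here refl))
normalise (init₂ p) ρ = neutral⇒normal (ρ (here refl))
normalise (⊃-left {Γ = Γ} d e) ρ =
  normalise e (extend (⊃E-neutral (ρ (here refl)) (normalise d (ρ ∘ there ∘ xs⊆xs++ys Γ _)))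
                      (ρ ∘ there ∘ xs⊆ys++xs _ Γ))
normalise (⊃-right d) ρ = ⊃I-normal (normalise d (lift ρ))
normalise (∧-left d) ρ =
  normalise d (extend (∧E₁-neutral (ρ (here refl)))
              (extend (∧E₂-neutral (ρ (here refl))) (ρ ∘ there)))
normalise (∧-right d e) ρ = ∧I-normal (normalise d ρ) (normalise e ρ)
normalise (∨-left d e) ρ =
  ∨E-normal (ρ (here refl)) (normalise d (lift (ρ ∘ there))) (normalise e (lift (ρ ∘ there)))
normalise (∨-right₁ d) ρ = ∨I₁-normal (normalise d ρ)
normalise (∨-right₂ d) ρ = ∨I₂-normal (normalise d ρ)
normalise (∼-left d) ρ = normalise d (extend (∼∼E-neutral (ρ (here refl))) (ρ ∘ there))
normalise (∼-right d) ρ = ∼∼I-normal (normalise d ρ)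
normalise (∼⊃-left {Γ = Γ} d e) ρ =
  normalise e (extend (∼⊃E-neutral (ρ (here refl)) (normalise d (ρ ∘ there ∘ xs⊆xs++ys Γ _)))
                      (ρ ∘ there ∘ xs⊆ys++xs _ Γ))
normalise (∼⊃-right d) ρ = ∼⊃I-normal (normalise d (lift ρ))
normalise (∼∧-left d e) ρ =
  ∼∧E-normal (ρ (here refl)) (normalise d (lift (ρ ∘ there))) (normalise e (lift (ρ ∘ there)))
normalise (∼∧-right₁ d) ρ = ∼∧I₁-normal (normalise d ρ)
normalise (∼∧-right₂ d) ρ = ∼∧I₂-normal (normalise d ρ)
normalise (∼∨-left d) ρ =
  normalise d (extend (∼∨E₁-neutral (ρ (here refl)))
              (extend (∼∨E₂-neutral (ρ (here refl))) (ρ ∘ there)))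
normalise (∼∨-right d e) ρ = ∼∨I-normal (normalise d ρ) (normalise e ρ)
normalise (ex-middle em d e) ρ =
  EM-normal em (normalise d (lift ρ)) (normalise e (lift ρ))
normalise (g-ex-middle gem d e) ρ =
  GEM-normal gem (normalise d (lift ρ)) (normalise e (lift ρ))

lemma3p7 : (L : Logic) (Γ : List Formula) (β : Formula) →
    ((D : Derivation L) → oa D ∼[ set ] Γ → end D ≡ β → L [ with-cut ]⊢ Γ ⇒ β)
    × (L [ without-cut ]⊢ Γ ⇒ β →
    Σ[ D′ ∈ Derivation L ] (oa D′ ⊆ Γ × end D′ ≡ β × Normal D′))
lemma3p7 L Γ β = (λ { D s refl → sound (tree D) (Equivalence.to s) }) , to-normal
  where
  -- Each formula of `Γ` starts out as its own one-node derivation.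
  assumption : Environment L Γ Γ
  assumption i = neutral (λ { (here refl) → i }) (assume _) id id

  to-normal : L [ without-cut ]⊢ Γ ⇒ β →
    Σ[ D′ ∈ Derivation L ] (oa D′ ⊆ Γ × end D′ ≡ β × Normal D′)
  to-normal d with normalise d assumption
  ... | normal p D m = derivation D , p , refl , m
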